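{- Let $k,n$ be positive integers with $k\leqslant n$ and let $Y\subseteq\mathrm{Conf}_k([n])$ be an order ideal with respect to the Bruhat order. Then every linear extension of $Y$ is a flag shelling order.
   Context: $[n]:=\{1,\ldots,n\}$. $[n]^i_<$ denotes the set of $i$-element subsets of $[n]$, identified with increasing $i$-tuples; its Bruhat order is $u\leqslant v$ iff $u_j\leqslant v_j$ for all $j\in[i]$. $\mathrm{Conf}_k([n])$ is the set of $k$-tuples $(a_1,\ldots,a_k)$ of pairwise distinct elements of $[n]$. For $x\in\mathrm{Conf}_k([n])$ and $i\in[k]$, $P^{(i)}(x)\in[n]^i_<$ is the increasing rearrangement of $\{x_1,\ldots,x_i\}$. The Bruhat order on $\mathrm{Conf}_k([n])$ is $x\leqslant y$ iff $P^{(i)}(x)\leqslant P^{(i)}(y)$ for all $i\in[k]$. An order ideal is a subset $Y$ with $y\in Y$, $x\leqslant y$ implying $x\in Y$. A linear extension of $Y$ is a tuple $(L_1,\ldots,L_h)$ listing each element of $Y$ exactly once such that $L_i<L_j$ implies $i<j$. For $y\in\mathrm{Conf}_k([n])$ let $P(y):=\{P^{(1)}(y),\ldots,P^{(k)}(y)\}$ (a $k$-element set whose elements are subsets of $[n]$). A sequence $(F_1,\ldots,F_h)$ of distinct $k$-element sets is a shelling order if for all $i<j$ there exists $z<j$ with $|F_z\cap F_j|=|F_j|-1$ and $F_i\cap F_j\subseteq F_z\cap F_j$. A tuple $(a_1,\ldots,a_h)$ listing the elements of $Y$ is a flag shelling order for $Y$ if $(P(a_1),\ldots,P(a_h))$ is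 a shelling order (of the simplicial complex with facets $\{P(y):y\in Y\}$). -}

module Defs where

open import Data.Fin using (Fin; toℕ; _≤_; _<_)
open import Data.Fin.Properties using (≤-decTotalOrder; _≟_)
open import Data.List using (List; length; filter; take; tabulate)
import Data.List.Membership.DecPropositional as DecMembership
open import Data.List.Properties using (≡-dec)
open import Data.List.Relation.Binary.BagAndSetEquality using (_∼[_]_; set)
open import Data.List.Relation.Binary.Pointwise using (Pointwise)
open import Data.List.Relation.Binary.Subset.Propositional using (_⊆_)
open import Data.List.Relation.Unary.Unique.Propositional using (Unique)
import Data.List.Sort as Sort
open import Data.Nat using (ℕ; suc)
open import Data.Product using (_×_; ∃-syntax)
open import Data.Vec using (Vec; toList)
import Data.Vec.Relation.Unary.Unique.Propositional as Vec
open import Function.Definitions using (Injective)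
open import Level using (Level)
open import Relation.Binary.Definitions using (DecidableEquality)
open import Relation.Binary.PropositionalEquality using (_≡_; _≢_)
open import Relation.Nullary using (¬_)
open import Relation.Unary using (Pred) renaming (_∈_ to _∈ₚ_)

private
  variable
    ℓ : Level
    k n h : ℕ

-- The distinctness proof is irrelevant, so _≡_ on Conf is equality of tuples.
record Conf (k n : ℕ) : Set where
  constructor conf
  field
    entries   : Vec (Fin n) k
    .distinct : Vec.Unique entries

open Conf public

-- A subset of [n] is represented by its increasing list of elements, so that
-- equality of subsets is _≡_ of lists.  The index i : Fin k is zero-based:
-- P i x is the increasing rearrangement of the first (toℕ i + 1) entries of x.
P : Fin k → Conf k n → List (Fin n)
P {n = n} i x = Sort.sort (≤-decTotalOrder n) (take (suc (toℕ i)) (toList (entries x)))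

infix 4 _≤ᴮ_ _<ᴮ_

_≤ᴮ_ : Conf k n → Conf k n → Set
x ≤ᴮ y = ∀ i → Pointwise _≤_ (P i x) (P i y)

_<ᴮ_ : Conf k n → Conf k n → Set
x <ᴮ y = x ≤ᴮ y × x ≢ y

IsOrderIdeal : Pred (Conf k n) ℓ → Set ℓ
IsOrderIdeal Y = ∀ {x y} → y ∈ₚ Y → x ≤ᴮ y → x ∈ₚ Y

record Lists (Y : Pred (Conf k n) ℓ) (L : Fin h → Conf k n) : Set ℓ where
  field
    sound     : ∀ i → L i ∈ₚ Y
    complete  : ∀ {y} → y ∈ₚ Y → ∃[ i ] L i ≡ y
    injective : Injective _≡_ _≡_ L

record IsLinearExtension (Y : Pred (Conf k n) ℓ) (L : Fin h → Conf k n) : Set ℓ where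
  field
    lists    : Lists Y L
    monotone : ∀ i j → L i <ᴮ L j → i < j

-- Finite sets of elements of A are duplicate-free lists, so length is the
-- cardinality; equality of such sets is _∼[ set ]_, not _≡_.
module Shelling {A : Set} (_≟ᴬ_ : DecidableEquality A) where

  open DecMembership _≟ᴬ_ using (_∈?_)

  infixr 7 _∩_

  _∩_ : List A → List A → List A
  F ∩ G = filter (_∈? G) F

  record IsShellingOrder (k : ℕ) (F : Fin h → List A) : Set where
    field
      unique   : ∀ i → Unique (F i)
      size     : ∀ i → length (F i) ≡ k
      distinct : ∀ i j → i ≢ j → ¬ (F i ∼[ set ] F j)
      shelling : ∀ i j → i < j →
                 ∃[ z ] z < j
                      × suc (length (F z ∩ F j)) ≡ length (F j)
                      × F i ∩ F j ⊆ F z ∩ F j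

flag : Conf k n → List (List (Fin n))
flag y = tabulate (λ i → P i y)

record IsFlagShellingOrder (Y : Pred (Conf k n) ℓ) (a : Fin h → Conf k n) : Set ℓ where
  open Shelling (≡-dec (_≟_ {n = n}))
  field
    lists         : Lists Y a
    shellingOrder : IsShellingOrder k (λ i → flag (a i))

{-# OPTIONS --safe #-}
-- For i < j put x = L i and y = L j; then y ≰ x.  Call q a descent of y if
-- y_q > y_{q+1}, or if q = k and some unused value is smaller than y_k.
-- Exchanging y_q and y_{q+1}, or lowering y_k, yields z < y whose flag differs
-- from that of y exactly in the q-th subset, so it suffices to find a descent q
-- with P^(q)(x) ≠ P^(q)(y).  As y ≰ x, some prefix of x has more entries ≤ v
-- than the prefix of y of the same length p.  For the least such p we have
-- y_p > v; while p is not a descent, y_{p+1} > y_p > v, so the strict inequality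
-- passes on to p + 1.  If this goes on up to p = k, some value ≤ v < y_k does
-- not occur in y, and k is a descent.
module Submission where

open import Defs
open import Data.Fin as Fin using (Fin; zero; suc; toℕ)
import Data.Fin.Properties as Fin
open import Data.List using (List; []; _∷_; [_]; _++_; length; filter; take; tabulate)
open import Data.List.Membership.Propositional using (_∈_; _∉_)
import Data.List.Membership.DecPropositional as DecMembership
open import Data.List.Membership.Propositional.Properties
  using (∈-∃++; ∈-filter⁺; ∈-filter⁻; ∈-tabulate⁺; ∈-tabulate⁻)
open import Data.List.Properties
  using (filter-++; filter-accept; filter-all; filter-none; filter-reject; length-++;
         length-filter; length-tabulate; length-take; ≡-dec)
open import Data.List.Relation.Binary.BagAndSetEquality using (_∼[_]_; set)
open import Data.List.Relation.Binary.Permutation.Propositional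
  using (_↭_; prep; swap; ↭-refl; ↭-sym; ↭-trans; ↭⇒↭ₛ)
open import Data.List.Relation.Binary.Permutation.Propositional.Properties
  using (∈-resp-↭; filter-↭; shift; ↭-length)
open import Data.List.Relation.Binary.Pointwise as Pointwise using (Pointwise; []; _∷_)
open import Data.List.Relation.Binary.Subset.Propositional using (_⊆_)
open import Data.List.Relation.Unary.All as All using (All; []; _∷_)
open import Data.List.Relation.Unary.AllPairs using (AllPairs; []; _∷_)
open import Data.List.Relation.Unary.Any using (here; there)
import Data.List.Relation.Unary.All.Properties as All
open import Data.List.Relation.Unary.Sorted.TotalOrder.Properties using (Sorted⇒AllPairs; ↗↭↗⇒≋)
open import Data.List.Relation.Unary.Unique.Propositional using (Unique)
import Data.List.Relation.Unary.Unique.Propositional.Properties as Unique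
import Data.List.Sort as Sort
open import Data.Nat as ℕ using (ℕ; zero; suc; _+_; _≤_; _<_; z≤n; s≤s; NonZero)
import Data.Nat.Properties as ℕ
open import Data.Product using (_×_; _,_; ∃-syntax; proj₁)
open import Data.Vec using (Vec; []; _∷_; toList)
open import Data.Vec.Properties using (length-toList)
import Data.Vec.Relation.Unary.All as AllV
import Data.Vec.Relation.Unary.All.Properties as AllV
import Data.Vec.Relation.Unary.AllPairs as AllPairsV
import Data.Vec.Relation.Unary.Unique.Propositional as UniqueV
open import Function using (_∘_)
open import Function.Bundles using (Equivalence)
open import Level using (Level; 0ℓ)
open import Relation.Binary.Definitions using (tri<; tri≈; tri>)
open import Relation.Binary.PropositionalEquality
  using (_≡_; _≢_; refl; sym; trans; cong; subst; subst₂)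
open import Relation.Nullary using (¬_; yes; no; contradiction; recompute)
open import Relation.Nullary.Decidable using (¬?; _×-dec_)
open import Relation.Unary using (Pred; Decidable)

private
  variable
    A : Set
    k n m : ℕ

-- Lists without repetitions

unique-⊆⇒length≤ : {xs ys : List A} → Unique xs → xs ⊆ ys → length xs ≤ length ys
unique-⊆⇒length≤ [] _ = z≤n
unique-⊆⇒length≤ {xs = a ∷ xs} (a∉xs ∷ uxs) sub with ∈-∃++ (sub (here refl))
... | ps , qs , refl =
  -- `a` is moved to the front of `ys`; the tail of `xs`, which does not contain `a`, then fits into
  -- `ps ++ qs`.
  subst (suc (length xs) ≤_) (sym (↭-length (shift a ps qs))) (s≤s (unique-⊆⇒length≤ uxs sub′))
  where
  sub′ : xs ⊆ ps ++ qs
  sub′ w∈xs with ∈-resp-↭ (shift a ps qs) (sub (there w∈xs))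
  ... | here refl = contradiction refl (All.lookup a∉xs w∈xs)
  ... | there w∈  = w∈

-- To be applied to the flag of `z` and membership in the flag of `y`, where only the set at the
-- descent is lost.
length-filter-tabulate : {P : Pred A 0ℓ} (P? : Decidable P) (f : Fin k → A) (q : Fin k) →
  ¬ P (f q) → (∀ i → i ≢ q → P (f i)) → suc (length (filter P? (tabulate f))) ≡ k
length-filter-tabulate P? f zero ¬Pq P-else =
  cong suc (trans (cong length (trans (filter-reject P? ¬Pq)
                                      (filter-all P? (All.tabulate⁺ λ i → P-else (suc i) λ ()))))
                  (length-tabulate (f ∘ suc)))
length-filter-tabulate P? f (suc q) ¬Pq P-else =
  cong suc (trans (cong length (filter-accept P? (P-else zero λ ())))
                  (length-filter-tabulate P? (f ∘ suc) q ¬Pq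
                     λ i i≢q → P-else (suc i) (i≢q ∘ Fin.suc-injective)))

toList-unique : {xs : Vec A m} → UniqueV.Unique xs → Unique (toList xs)
toList-unique AllPairsV.[]          = []
toList-unique (x∉xs AllPairsV.∷ u) = AllV.toList⁺ x∉xs ∷ toList-unique u

-- Counting the entries up to a threshold

count : Fin n → List (Fin n) → ℕ
count v xs = length (filter (Fin._≤? v) xs)

count-∷ : (v c : Fin n) (xs : List (Fin n)) → count v (c ∷ xs) ≡ count v [ c ] + count v xs
count-∷ v c xs = trans (cong length (filter-++ (Fin._≤? v) [ c ] xs))
                       (length-++ (filter (Fin._≤? v) [ c ]))

count-≤ : {v c : Fin n} → c Fin.≤ v → count v [ c ] ≡ 1
count-≤ {v = v} c≤v = cong length (filter-accept (Fin._≤? v) c≤v)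

count-> : {v c : Fin n} → v Fin.< c → count v [ c ] ≡ 0
count-> {v = v} v<c = cong length (filter-reject (Fin._≤? v) (ℕ.<⇒≱ v<c))

count-∷-≤ : {v c : Fin n} (xs : List (Fin n)) → c Fin.≤ v → count v (c ∷ xs) ≡ suc (count v xs)
count-∷-≤ {v = v} xs c≤v = cong length (filter-accept (Fin._≤? v) c≤v)

count-all> : {v : Fin n} {xs : List (Fin n)} → All (v Fin.<_) xs → count v xs ≡ 0
count-all> {v = v} v<xs = cong length (filter-none (Fin._≤? v) (All.map ℕ.<⇒≱ v<xs))

count-antitone : (v : Fin n) {b c : Fin n} → c Fin.≤ b → count v [ b ] ≤ count v [ c ]
count-antitone v {b} {c} c≤b with b Fin.≤? v
... | yes b≤v = ℕ.≤-reflexive (trans (count-≤ b≤v) (sym (count-≤ (ℕ.≤-trans c≤b b≤v))))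
... | no  b≰v = subst (_≤ count v [ c ]) (sym (count-> (ℕ.≰⇒> b≰v))) z≤n

count-↭ : (v : Fin n) {xs ys : List (Fin n)} → xs ↭ ys → count v xs ≡ count v ys
count-↭ v p = ↭-length (filter-↭ (Fin._≤? v) p)

-- Otherwise the entries of `xs` up to `v` would all occur in `ys`, which would then have at least
-- as many of them. The value found is the one by which `lower` replaces the last entry.
count<⇒∃∉ : {v : Fin n} {xs ys : List (Fin n)} → Unique xs → count v ys < count v xs →
  ∃[ c ] c Fin.≤ v × c ∉ ys
count<⇒∃∉ {n = n} {v} {xs} {ys} uxs lt
  with Fin.any? (λ c → (c Fin.≤? v) ×-dec ¬? (c ∈? ys))
  where open DecMembership (Fin._≟_ {n})
... | yes found = found
... | no  none  = contradiction (unique-⊆⇒length≤ (Unique.filter⁺ (Fin._≤? v) uxs) sub) (ℕ.<⇒≱ lt)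
  where
  open DecMembership (Fin._≟_ {n})
  sub : filter (Fin._≤? v) xs ⊆ filter (Fin._≤? v) ys
  sub {c} c∈ with ∈-filter⁻ (Fin._≤? v) {xs = xs} c∈
  ... | _ , c≤v with c ∈? ys
  ... | yes c∈ys = ∈-filter⁺ (Fin._≤? v) c∈ys c≤v
  ... | no  c∉ys = contradiction (c , c≤v , c∉ys) none

-- The threshold `a` counts something in `a ∷ xs`, so `b` is at most `a`. For the tails, a threshold
-- from `a` on counts both heads, which cancel, and a threshold below `a` counts nothing in `xs`.
sorted-count⇒≤ : {xs ys : List (Fin n)} → AllPairs Fin._≤_ xs → AllPairs Fin._≤_ ys →
  length xs ≡ length ys → (∀ v → count v xs ≤ count v ys) → Pointwise Fin._≤_ ys xs
sorted-count⇒≤ [] [] _ _ = []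
sorted-count⇒≤ {xs = a ∷ xs} {b ∷ ys} (a≤xs ∷ sxs) (b≤ys ∷ sys) len cnt =
  b≤a ∷ sorted-count⇒≤ sxs sys (ℕ.suc-injective len) cnt′
  where
  b≤a : b Fin.≤ a
  b≤a with b Fin.≤? a
  ... | yes p = p
  ... | no ¬p = contradiction (cnt a) (ℕ.<⇒≱
    (subst₂ _<_ (sym (count-all> (ℕ.≰⇒> ¬p ∷ All.map (ℕ.<-≤-trans (ℕ.≰⇒> ¬p)) b≤ys)))
                (sym (count-∷-≤ {v = a} {a} xs ℕ.≤-refl)) (s≤s z≤n)))
  cnt′ : ∀ v → count v xs ≤ count v ys
  cnt′ v with a Fin.≤? v
  ... | yes a≤v = ℕ.s≤s⁻¹ (subst₂ _≤_ (count-∷-≤ xs a≤v) (count-∷-≤ ys (ℕ.≤-trans b≤a a≤v)) (cnt v))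
  ... | no ¬a≤v =
    subst (_≤ count v ys) (sym (count-all> (All.map (ℕ.<-≤-trans (ℕ.≰⇒> ¬a≤v)) a≤xs))) z≤n

-- Prefixes, and the Bruhat order in terms of counts

entries-unique : (x : Conf k n) → UniqueV.Unique (entries x)
-- Distinctness is decidable, so the irrelevant field can be recomputed into a usable proof.
entries-unique (conf xs u) = recompute (AllPairsV.allPairs? (λ a b → ¬? (a Fin.≟ b)) xs) u

prefix : Fin k → Conf k n → List (Fin n)
prefix i x = take (suc (toℕ i)) (toList (entries x))

P-↭ : (i : Fin k) (x : Conf k n) → P i x ↭ prefix i x
P-↭ {n = n} i x = Sort.sort-↭ (Fin.≤-decTotalOrder n) (prefix i x)

P-sorted : (i : Fin k) (x : Conf k n) → AllPairs Fin._≤_ (P i x)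
P-sorted {n = n} i x =
  Sorted⇒AllPairs (Fin.≤-totalOrder n) (Sort.sort-↗ (Fin.≤-decTotalOrder n) (prefix i x))

length-P : (i : Fin k) (x : Conf k n) → length (P i x) ≡ suc (toℕ i)
length-P {k} i x =
  trans (↭-length (P-↭ i x))
 (trans (length-take (suc (toℕ i)) (toList (entries x)))
 (trans (cong (suc (toℕ i) ℕ.⊓_) (length-toList (entries x)))
        (ℕ.m≤n⇒m⊓n≡m (Fin.toℕ<n i))))

-- The sets of a flag have sizes 1 to `k`, so a set determines its index, even across two flags.
P-index : {i j : Fin k} {x y : Conf k n} → P i x ≡ P j y → i ≡ j
P-index {i = i} {j} {x} {y} eq =
  Fin.toℕ-injective (ℕ.suc-injective
    (trans (sym (length-P i x)) (trans (cong length eq) (length-P j y))))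

count-P : (v : Fin n) (i : Fin k) (x : Conf k n) → count v (P i x) ≡ count v (prefix i x)
count-P v i x = count-↭ v (P-↭ i x)

P-resp-↭ : (i : Fin k) (x y : Conf k n) → prefix i x ↭ prefix i y → P i x ≡ P i y
P-resp-↭ {n = n} i x y p = Pointwise.Pointwise-≡⇒≡
  (↗↭↗⇒≋ (Fin.≤-totalOrder n)
     (Sort.sort-↗ (Fin.≤-decTotalOrder n) (prefix i x))
     (Sort.sort-↗ (Fin.≤-decTotalOrder n) (prefix i y))
     (↭⇒↭ₛ (↭-trans (P-↭ i x) (↭-trans p (↭-sym (P-↭ i y))))))

count⇒≤ᴮ : (x y : Conf k n) → (∀ i v → count v (prefix i y) ≤ count v (prefix i x)) → x ≤ᴮ y
count⇒≤ᴮ x y cnt i =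
  sorted-count⇒≤ (P-sorted i y) (P-sorted i x) (trans (length-P i y) (sym (length-P i x)))
    λ v → subst₂ _≤_ (sym (count-P v i y)) (sym (count-P v i x)) (cnt i v)

-- Only finitely many pairs of `i` and `v` need testing, so the failure of the order yields a
-- witness constructively.
≰ᴮ⇒count< : (x y : Conf k n) → ¬ (y ≤ᴮ x) →
  ∃[ i ] ∃[ v ] count v (prefix i y) < count v (prefix i x)
≰ᴮ⇒count< x y y≰x
  with Fin.any? (λ i → Fin.any? (λ v → count v (prefix i y) ℕ.<? count v (prefix i x)))
... | yes found = found
... | no  none  = contradiction (count⇒≤ᴮ y x λ i v → ℕ.≮⇒≥ λ lt → none (i , v , lt)) y≰x

-- Descents and their effect on prefixes

-- Undoing a descent; Fresh is to be the set of values unused by the whole tuple.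
data Descent (Fresh : Pred (Fin n) 0ℓ) : Vec (Fin n) m → Fin m → Vec (Fin n) m → Set where
  exchange : ∀ {b c} {ys : Vec (Fin n) m} → c Fin.< b →
             Descent Fresh (b ∷ c ∷ ys) zero (c ∷ b ∷ ys)
  lower    : ∀ {b c} → c Fin.< b → Fresh c → Descent Fresh (b ∷ []) zero (c ∷ [])
  skip     : ∀ {a q} {ys zs : Vec (Fin n) m} → Descent Fresh ys q zs →
             Descent Fresh (a ∷ ys) (suc q) (a ∷ zs)

module _ {Fresh : Pred (Fin n) 0ℓ} where

  -- A prefix either keeps its entries up to order or has `b` replaced by the smaller `c`, which can
  -- only raise a count. By `count⇒≤ᴮ` the new tuple then lies below the old one.
  descent-count≤ : ∀ {ys zs : Vec (Fin n) m} {q} → Descent Fresh ys q zs →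
    ∀ i v → count v (take i (toList ys)) ≤ count v (take i (toList zs))
  descent-count≤ d zero v = z≤n
  descent-count≤ (exchange c<b) (suc zero) v = count-antitone v (ℕ.<⇒≤ c<b)
  descent-count≤ (exchange {b = b} {c} c<b) (suc (suc i)) v =
    ℕ.≤-reflexive (count-↭ v (swap b c ↭-refl))
  descent-count≤ (lower c<b _) (suc zero) v = count-antitone v (ℕ.<⇒≤ c<b)
  descent-count≤ (lower c<b _) (suc (suc i)) v = count-antitone v (ℕ.<⇒≤ c<b)
  descent-count≤ (skip {a = a} {ys = ys} {zs} d) (suc i) v
    rewrite count-∷ v a (take i (toList ys)) | count-∷ v a (take i (toList zs)) =
    ℕ.+-monoʳ-≤ (count v [ a ]) (descent-count≤ d i v)

  descent-count< : ∀ {ys zs : Vec (Fin n) m} {q} → Descent Fresh ys q zs →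
    ∃[ v ] count v (take (suc (toℕ q)) (toList ys)) < count v (take (suc (toℕ q)) (toList zs))
  descent-count< (exchange {c = c} c<b) =
    -- The threshold `c` separates the two entries: it counts `c` but not `b`.
    c , subst₂ _<_ (sym (count-> c<b)) (sym (count-≤ {v = c} ℕ.≤-refl)) (s≤s z≤n)
  descent-count< (lower {c = c} c<b _) =
    c , subst₂ _<_ (sym (count-> c<b)) (sym (count-≤ {v = c} ℕ.≤-refl)) (s≤s z≤n)
  descent-count< (skip {a = a} {q} {ys} {zs} d) with descent-count< d
  ... | v , lt = v ,
    subst₂ _<_ (sym (count-∷ v a (take (suc (toℕ q)) (toList ys))))
               (sym (count-∷ v a (take (suc (toℕ q)) (toList zs))))
               (ℕ.+-monoʳ-< (count v [ a ]) lt)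

  descent-↭ : ∀ {ys zs : Vec (Fin n) m} {q} → Descent Fresh ys q zs → ∀ i → i ≢ q →
    take (suc (toℕ i)) (toList ys) ↭ take (suc (toℕ i)) (toList zs)
  descent-↭ (exchange c<b) zero i≢q = contradiction refl i≢q
  descent-↭ (exchange {b = b} {c} c<b) (suc i) i≢q = swap b c ↭-refl
  descent-↭ (lower _ _) zero i≢q = contradiction refl i≢q
  descent-↭ (skip d) zero i≢q = ↭-refl
  descent-↭ (skip {a = a} d) (suc i) i≢q = prep a (descent-↭ d i (i≢q ∘ cong suc))

  descent-all : ∀ {P : Pred (Fin n) 0ℓ} {ys zs : Vec (Fin n) m} {q} → (∀ {c} → Fresh c → P c) →
    Descent Fresh ys q zs → AllV.All P ys → AllV.All P zs
  descent-all f (exchange _) (pb AllV.∷ pc AllV.∷ ps) = pc AllV.∷ pb AllV.∷ ps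
  descent-all f (lower _ fr) (_ AllV.∷ ps) = f fr AllV.∷ ps
  descent-all f (skip d) (pa AllV.∷ ps) = pa AllV.∷ descent-all f d ps

  -- Freshness is demanded entry by entry because `Fresh` keeps referring to the whole tuple while
  -- the recursion passes to its tails.
  descent-unique : ∀ {ys zs : Vec (Fin n) m} {q} → AllV.All (λ a → ∀ {c} → Fresh c → a ≢ c) ys →
    Descent Fresh ys q zs → UniqueV.Unique ys → UniqueV.Unique zs
  descent-unique _ (exchange _) ((b≢c AllV.∷ b∉) AllPairsV.∷ c∉ AllPairsV.∷ u) =
    ((b≢c ∘ sym) AllV.∷ c∉) AllPairsV.∷ b∉ AllPairsV.∷ u
  descent-unique _ (lower _ _) _ = AllV.[] AllPairsV.∷ AllPairsV.[]
  descent-unique (fa AllV.∷ fs) (skip d) (a∉ AllPairsV.∷ u) =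
    descent-all fa d a∉ AllPairsV.∷ descent-unique fs d u

  -- Searching for a descent where the prefixes differ

  -- In the next two lemmas s and t are the counts of the entries ≤ v in the
  -- parts of the two tuples that have already been read.
  module _ (v : Fin n) where

    private
      step : ∀ s c (l : List (Fin n)) → s + count v (c ∷ l) ≡ (s + count v [ c ]) + count v l
      step s c l = trans (cong (s +_) (count-∷ v c l)) (sym (ℕ.+-assoc s _ _))

    -- The entry `b` has been read already and adds nothing to `s`, as `v < b`. Hence `take (toℕ q)`
    -- of the rest completes the prefix of `b ∷ ys` that ends at position `q`.
    descent-after : ∀ {b} (ys xs : Vec (Fin n) m) {s t} → v Fin.< b → s < t →
      (s + count v (toList ys) < t + count v (toList xs) → ∃[ c ] c Fin.≤ v × Fresh c) →
      ∃[ q ] ∃[ zs ] Descent Fresh (b ∷ ys) q zs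
        × s + count v (take (toℕ q) (toList ys)) < t + count v (take (toℕ q) (toList xs))
    descent-after [] [] v<b s<t fresh with fresh (ℕ.+-monoˡ-< 0 s<t)
    ... | c , c≤v , fc = zero , _ , lower (ℕ.≤-<-trans c≤v v<b) fc , ℕ.+-monoˡ-< 0 s<t
    descent-after {b = b} (c ∷ ys) (d ∷ xs) {s} {t} v<b s<t fresh with c Fin.<? b
    ... | yes c<b = zero , _ , exchange c<b , ℕ.+-monoˡ-< 0 s<t
    ... | no  c≮b
      -- Without a descent here, `c` is at least `b`, exceeds `v` and adds nothing on the left; the
      -- strict inequality survives.
      with v<c ← ℕ.<-≤-trans v<b (ℕ.≮⇒≥ c≮b)
      with descent-after ys xs v<c
             (subst (_< t + count v [ d ])
                    (sym (trans (cong (s +_) (count-> v<c)) (ℕ.+-identityʳ s)))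
                    (ℕ.<-≤-trans s<t (ℕ.m≤m+n t _)))
             (fresh ∘ subst₂ _<_ (sym (step s c (toList ys))) (sym (step t d (toList xs))))
    ... | q , zs , D , lt = suc q , _ , skip D ,
      subst₂ _<_ (sym (step s c (take (toℕ q) (toList ys))))
                 (sym (step t d (take (toℕ q) (toList xs)))) lt

    -- The bound `t ≤ s` says that the strict inequality has not yet occurred; the index `i`
    -- guarantees that it will. The premise of `fresh` compares the whole tuples, so it passes to
    -- the tails by regrouping the sums.
    find-descent : ∀ (ys xs : Vec (Fin n) m) {s t} → t ≤ s →
      (i : ℕ) → s + count v (take i (toList ys)) < t + count v (take i (toList xs)) →
      (s + count v (toList ys) < t + count v (toList xs) → ∃[ c ] c Fin.≤ v × Fresh c) →
      ∃[ q ] ∃[ zs ] Descent Fresh ys q zs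
        × s + count v (take (suc (toℕ q)) (toList ys)) < t + count v (take (suc (toℕ q)) (toList xs))
    find-descent ys xs t≤s zero lt fresh = contradiction (ℕ.+-monoˡ-≤ 0 t≤s) (ℕ.<⇒≱ lt)
    find-descent [] [] t≤s (suc i) lt fresh = contradiction (ℕ.+-monoˡ-≤ 0 t≤s) (ℕ.<⇒≱ lt)
    find-descent (c ∷ ys) (d ∷ xs) {s} {t} t≤s (suc i) lt fresh
      with fresh′ ← fresh ∘ subst₂ _<_ (sym (step s c (toList ys))) (sym (step t d (toList xs)))
      with t + count v [ d ] ℕ.≤? s + count v [ c ]
    ... | yes t′≤s′
      with find-descent ys xs t′≤s′ i
             (subst₂ _<_ (step s c (take i (toList ys))) (step t d (take i (toList xs))) lt) fresh′
    ... | q , zs , D , lt′ = suc q , _ , skip D ,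
      subst₂ _<_ (sym (step s c (take (suc (toℕ q)) (toList ys))))
                 (sym (step t d (take (suc (toℕ q)) (toList xs)))) lt′
    find-descent (c ∷ ys) (d ∷ xs) {s} {t} t≤s (suc i) lt fresh | no t′≰s′
      with descent-after ys xs v<c (ℕ.≰⇒> t′≰s′) fresh′
      where
      v<c : v Fin.< c
      -- If `c ≤ v`, then `c` counts 1, at least as much as `d`, and the bound would persist.
      v<c = ℕ.≰⇒> λ c≤v → t′≰s′ (ℕ.+-mono-≤ t≤s
        (subst (count v [ d ] ≤_) (sym (count-≤ c≤v)) (length-filter (Fin._≤? v) [ d ])))
    ... | q , zs , D , lt′ = q , zs , D ,
      subst₂ _<_ (sym (step s c (take (toℕ q) (toList ys))))
                 (sym (step t d (take (toℕ q) (toList xs)))) lt′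

-- Flags of tuples related by a descent

P-∈-flag : {i : Fin k} (x y : Conf k n) → P i x ∈ flag y → P i x ≡ P i y
P-∈-flag x y Pix∈ with ∈-tabulate⁻ Pix∈
... | j , eq with P-index {x = x} {y} eq
... | refl = eq

∃-descent : (x y : Conf k n) → ¬ (y ≤ᴮ x) →
  ∃[ z ] ∃[ q ] z <ᴮ y × P q z ≢ P q y × P q x ≢ P q y × (∀ i → i ≢ q → P i z ≡ P i y)
∃-descent {k} {n} x y y≰x with ≰ᴮ⇒count< x y y≰x
... | i , v , lt
  -- The search starts with nothing read, so both initial counts are 0.
  with find-descent {Fresh = _∉ toList (entries y)} v (entries y) (entries x) z≤n (suc (toℕ i)) lt
         (count<⇒∃∉ (toList-unique (entries-unique x)))
... | q , zs , D , lt′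
  = z , q , (count⇒≤ᴮ z y (descent-count≤ D ∘ suc ∘ toℕ) , z≢y) , Pz≢Py , Px≢Py , else
  where
  z : Conf k n
  z = conf zs (descent-unique (AllV.toList⁻ (All.tabulate λ { a∈y c∉y refl → c∉y a∈y }))
                D (entries-unique y))
  Pz≢Py : P q z ≢ P q y
  Pz≢Py eq with descent-count< D
  ... | w , lt″ = ℕ.<⇒≢ lt″
    (trans (sym (count-P w q y)) (trans (cong (count w) (sym eq)) (count-P w q z)))
  z≢y : z ≢ y
  z≢y eq = Pz≢Py (cong (P q) eq)
  Px≢Py : P q x ≢ P q y
  Px≢Py eq = ℕ.<⇒≢ lt′
    (trans (sym (count-P v q y)) (trans (cong (count v) (sym eq)) (count-P v q x)))
  else : ∀ j → j ≢ q → P j z ≡ P j y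
  else j j≢q = P-resp-↭ j z y (↭-sym (descent-↭ D j j≢q))

module _ {k n : ℕ} where

  open Shelling (≡-dec (Fin._≟_ {n})) using (_∩_)
  open DecMembership (≡-dec (Fin._≟_ {n})) using (_∈?_)

  length-flag-∩ : (z y : Conf k n) (q : Fin k) → P q z ≢ P q y →
    (∀ i → i ≢ q → P i z ≡ P i y) → suc (length (flag z ∩ flag y)) ≡ length (flag y)
  length-flag-∩ z y q Pz≢ Pz≡ = trans
    (length-filter-tabulate (_∈? flag y) (λ i → P i z) q (Pz≢ ∘ P-∈-flag z y)
       (λ i i≢q → subst (_∈ flag y) (sym (Pz≡ i i≢q)) (∈-tabulate⁺ i)))
    (sym (length-tabulate (λ i → P i y)))

  -- By size, a set common to the flags of `x` and `y` has the same index in both. That index is not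
  -- `q`, and away from `q` the flags of `z` and `y` agree.
  flag-∩-⊆ : (x z y : Conf k n) (q : Fin k) → P q x ≢ P q y →
    (∀ i → i ≢ q → P i z ≡ P i y) → flag x ∩ flag y ⊆ flag z ∩ flag y
  flag-∩-⊆ x z y q Px≢ Pz≡ {S} S∈ = both (∈-filter⁻ (_∈? flag y) {xs = flag x} S∈)
    where
    member : ∃[ i ] S ≡ P i x → S ∈ flag y → S ∈ flag z
    member (i , refl) S∈y = subst (_∈ flag z) (sym Pix≡Piz) (∈-tabulate⁺ i)
      where
      Pix≡Piy : P i x ≡ P i y
      Pix≡Piy = P-∈-flag x y S∈y
      Pix≡Piz : P i x ≡ P i z
      Pix≡Piz = trans Pix≡Piy (sym (Pz≡ i λ { refl → Px≢ Pix≡Piy }))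

    both : S ∈ flag x × S ∈ flag y → S ∈ flag z ∩ flag y
    both (S∈x , S∈y) = ∈-filter⁺ (_∈? flag y) (member (∈-tabulate⁻ S∈x) S∈y) S∈y

-- Linear extensions as shelling orders

theorem4p5 : ∀ {ℓ : Level} (k n : ℕ) .{{_ : NonZero k}} .{{_ : NonZero n}} → k ≤ n →
    (Y : Pred (Conf k n) ℓ) → IsOrderIdeal Y →
    (h : ℕ) (L : Fin h → Conf k n) → IsLinearExtension Y L → IsFlagShellingOrder Y L
theorem4p5 k n k≤n Y ideal h L ext = record
  { lists = lists
  ; shellingOrder = record
    { unique   = λ i → Unique.tabulate⁺ (λ {a} {b} → P-index {x = L i} {L i})
    ; size     = λ i → length-tabulate (λ a → P a (L i))
    ; distinct = flags-distinct
    ; shelling = shelling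
    }
  }
  where
  open IsLinearExtension ext
  open Lists lists
  open Shelling (≡-dec (Fin._≟_ {n})) using (_∩_)

  F : Fin h → List (List (Fin n))
  F i = flag (L i)

  later-≰ : ∀ {i j} → i Fin.< j → ¬ (L j ≤ᴮ L i)
  later-≰ {i} {j} i<j Lj≤Li =
    Fin.<-asym i<j (monotone j i (Lj≤Li , λ eq → Fin.<⇒≢ i<j (sym (injective eq))))

  -- Inclusion forces equality at every index. The conclusion is an inequality because this is what
  -- `later-≰` refutes.
  flag-⊆⇒≥ᴮ : ∀ (x y : Conf k n) → flag x ⊆ flag y → y ≤ᴮ x
  flag-⊆⇒≥ᴮ x y sub i =
    subst (λ S → Pointwise Fin._≤_ S (P i x))
          (P-∈-flag x y (sub (∈-tabulate⁺ i)))
          (Pointwise.refl Fin.≤-refl)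

  flags-distinct : ∀ i j → i ≢ j → ¬ (F i ∼[ set ] F j)
  flags-distinct i j i≢j eq with Fin.<-cmp i j
  ... | tri< i<j _ _ = later-≰ i<j (flag-⊆⇒≥ᴮ (L i) (L j) (Equivalence.to eq))
  ... | tri≈ _ i≡j _ = i≢j i≡j
  ... | tri> _ _ j<i = later-≰ j<i (flag-⊆⇒≥ᴮ (L j) (L i) (Equivalence.from eq))

  shelling : ∀ i j → i Fin.< j →
    ∃[ m ] m Fin.< j × suc (length (F m ∩ F j)) ≡ length (F j) × F i ∩ F j ⊆ F m ∩ F j
  shelling i j i<j = shell (∃-descent (L i) (L j) (later-≰ i<j))
    where
    shell : ∃[ z ] ∃[ q ] z <ᴮ L j × P q z ≢ P q (L j) × P q (L i) ≢ P q (L j)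
              × (∀ a → a ≢ q → P a z ≡ P a (L j)) →
            ∃[ m ] m Fin.< j × suc (length (F m ∩ F j)) ≡ length (F j) × F i ∩ F j ⊆ F m ∩ F j
    -- As `Y` is an ideal, `z` belongs to it and is some `L m`; the linear extension then places it
    -- before `L j`.
    shell (z , q , z<Lj , Pz≢ , Px≢ , Pz≡) = locate (complete (ideal (sound j) (proj₁ z<Lj)))
      where
      locate : ∃[ m ] L m ≡ z →
        ∃[ m ] m Fin.< j × suc (length (F m ∩ F j)) ≡ length (F j) × F i ∩ F j ⊆ F m ∩ F j
      locate (m , refl) =
        m , monotone m j z<Lj
          , length-flag-∩ (L m) (L j) q Pz≢ Pz≡
          , flag-∩-⊆ (L i) (L m) (L j) q Px≢ Pz≡
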